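{- Let $n\ge 2$ and $k\ge 1$ be integers, and let $\mathcal{A}_n$ denote the set of Dyck $n$-paths whose terminal descent has even length and all of whose other descents to ground level (if any) have odd length. Then there is a bijection between the paths in $\mathcal{A}_n$ having exactly $k$ returns and the Dyck $(n-1)$-paths that contain exactly $k-1$ early hills.
   Context: A Dyck $n$-path is a lattice path consisting of $n$ upsteps $U=(1,1)$ and $n$ downsteps $D=(1,-1)$ that starts and ends at height $0$ (ground level) and never goes below ground level. A descent is a maximal run of consecutive downsteps; its length is the number of downsteps in it. The terminal descent is the descent that ends at the final point of the path. A return is a downstep ending at ground level, and a descent to ground level is a descent whose last step is a return. An early hill is an occurrence of three consecutive steps $UDU$ in which the first $U$ starts at ground level. -}

module Defs where

open import Data.Integer.Base as ℤ using (ℤ; 0ℤ; 1ℤ; -1ℤ)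
import Data.Integer.Properties as ℤ
open import Data.List.Base
  using (List; []; _∷_; _++_; _∷ʳ_; filter; head; inits; last; length; map;
         replicate; tails; zip; foldr)
open import Data.List.Relation.Binary.Prefix.Heterogeneous using (Prefix)
open import Data.List.Relation.Binary.Prefix.Heterogeneous.Properties using (prefix?)
open import Data.Maybe.Base using (just)
open import Data.Nat.Base using (ℕ; _≤_)
open import Data.Nat.Divisibility using (_∣_)
open import Data.Product.Base using (Σ; _×_; _,_; proj₁)
open import Level using (0ℓ)
open import Relation.Binary.Bundles using (Setoid)
import Relation.Binary.Construct.On as On
open import Relation.Binary.Definitions using (DecidableEquality)
open import Relation.Binary.PropositionalEquality
  using (_≡_; _≢_; refl; setoid)
open import Relation.Nullary using (¬_; yes; no)
open import Relation.Nullary.Decidable using (_×-dec_)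
open import Relation.Unary using (Pred; Decidable)

data Step : Set where
  U D : Step

_≟_ : DecidableEquality Step
U ≟ U = yes refl
U ≟ D = no λ ()
D ≟ U = no λ ()
D ≟ D = yes refl

Path : Set
Path = List Step

#[_] : Step → Path → ℕ
#[ s ] p = length (filter (s ≟_) p)

rise : Step → ℤ
rise U = 1ℤ
rise D = -1ℤ

-- The height of the endpoint of a path that starts at ground level.
height : Path → ℤ
height p = foldr ℤ._+_ 0ℤ (map rise p)

record IsDyck (n : ℕ) (p : Path) : Set where
  field
    upsteps     : #[ U ] p ≡ n
    downsteps   : #[ D ] p ≡ n
    endsAtZero  : height p ≡ 0ℤ
    nonNegative : ∀ xs ys → p ≡ xs ++ ys → 0ℤ ℤ.≤ height xs

-- A maximal run of consecutive downsteps, located by the parts of the path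
-- before and after it.
record Descent (p : Path) : Set where
  field
    before after : Path
    len          : ℕ
    nonEmpty     : 1 ≤ len
    splitting    : p ≡ before ++ replicate len D ++ after
    maximalˡ     : last before ≢ just D
    maximalʳ     : head after ≢ just D

  IsTerminal : Set
  IsTerminal = after ≡ []

  ToGround : Set
  ToGround = height (before ++ replicate len D) ≡ 0ℤ

open Descent public using (len; IsTerminal; ToGround)

Even Odd : Pred ℕ 0ℓ
Even m = 2 ∣ m
Odd  m = ¬ Even m

-- A Dyck path with n ≥ 1 has exactly one terminal descent, so quantifying
-- over all terminal descents is not vacuous there.
record 𝒜 (n : ℕ) (p : Path) : Set where
  field
    isDyck       : IsDyck n p
    terminalEven : (d : Descent p) → IsTerminal d → Even (len d)
    othersOdd    : (d : Descent p) → ToGround d → ¬ IsTerminal d → Odd (len d)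

-- Every way of cutting a path at one of its lattice points, once each.
splits : Path → List (Path × Path)
splits p = zip (inits p) (tails p)

ReturnAt : Pred (Path × Path) 0ℓ
ReturnAt (xs , ys) = Prefix _≡_ (D ∷ []) ys × height (xs ∷ʳ D) ≡ 0ℤ

EarlyHillAt : Pred (Path × Path) 0ℓ
EarlyHillAt (xs , ys) = Prefix _≡_ (U ∷ D ∷ U ∷ []) ys × height xs ≡ 0ℤ

returnAt? : Decidable ReturnAt
returnAt? (xs , ys) = prefix? _≟_ (D ∷ []) ys ×-dec (height (xs ∷ʳ D) ℤ.≟ 0ℤ)

earlyHillAt? : Decidable EarlyHillAt
earlyHillAt? (xs , ys) =
  prefix? _≟_ (U ∷ D ∷ U ∷ []) ys ×-dec (height xs ℤ.≟ 0ℤ)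

returns : Path → ℕ
returns p = length (filter returnAt? (splits p))

earlyHills : Path → ℕ
earlyHills p = length (filter earlyHillAt? (splits p))

-- The paths satisfying P, equal when they are equal as paths: the proofs of
-- P do not count as data.
PathsWith : Pred Path 0ℓ → Setoid 0ℓ 0ℓ
PathsWith P = On.setoid {B = Σ Path P} (setoid Path) proj₁

{-# OPTIONS --safe #-}
-- Cut a Dyck path as l U r D before the last step U that leaves the ground;
-- then the terminal descent of l U r D is one longer than that of r.  A path
-- in 𝒜 is l U q U e D D where l is a sequence of k − 1 components U eᵢ D, and
-- e and all eᵢ have terminal descents of even length.  A nonempty path with
-- even terminal descent is in turn q U q' U e D D, with e of the same kind.
-- Trading each such double layer for one component U (q U q' D) D, which is
-- not a hill, and each component U eᵢ D of l for a hill encodes the pair (l , e)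
-- as an arbitrary Dyck path t with k − 1 hills.  The last component U q D then
-- makes all of them early: the bijection is l U q U e D D ↦ t U q D.
module Submission where

open import Defs
open import Data.Bool.Base using (true; false; if_then_else_; _∧_)
open import Data.Bool.Properties using (∧-zeroʳ)
open import Data.Empty using (⊥-elim)
open import Data.Integer.Base as ℤ using (ℤ; 0ℤ; 1ℤ; -1ℤ)
import Data.Integer.Properties as ℤ
open import Data.List.Base
  using (List; []; _∷_; _++_; _∷ʳ_; filter; head; inits; last; length; map; replicate; tails; zip)
open import Data.List.Properties
  using (++-assoc; ++-identityʳ; filter-++; length-++; map-id; ∷ʳ-injectiveˡ)
open import Data.List.Relation.Binary.Prefix.Heterogeneous using (Prefix)
open import Data.List.Relation.Binary.Prefix.Heterogeneous.Properties using (prefix?)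
open import Data.Maybe.Base using (just)
open import Data.Nat.Base using (ℕ; zero; suc; _+_; _≤_; _∸_; z≤n; s≤s)
open import Data.Nat.Divisibility
  using (∣1⇒≡1; ∣m+n∣m⇒∣n; ∣m∣n⇒∣m+n; ∣-refl; _∣0)
open import Data.Nat.Properties using (+-assoc; +-comm; +-suc; suc-injective; 1+n≢0)
open import Data.Product.Base using (∃; ∃₂; _×_; _,_; proj₁; proj₂)
open import Function.Base using (_∘_; id)
open import Function.Bundles using (Bijection)
open import Function.Properties.Inverse using (Inverse⇒Bijection)
open import Level using (0ℓ)
open import Relation.Binary.PropositionalEquality
  using (_≡_; _≢_; refl; sym; trans; cong; subst; module ≡-Reasoning)
open import Relation.Nullary using (¬_; does)
open import Relation.Nullary.Decidable using (_×-dec_)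
open import Relation.Unary using (Pred; Decidable)

-- Trees for Dyck paths, and the tree form of `𝒜`

infixl 6 _⟨_⟩ _⧺_

-- A node `l ⟨ r ⟩` stands for the path l U r D. The left spine then lists the components, and the
-- right spine has one node for each step of the terminal descent.
data Tree : Set where
  ε    : Tree
  _⟨_⟩ : Tree → Tree → Tree

flatten : Tree → Path
flatten ε         = []
flatten (l ⟨ r ⟩) = flatten l ++ U ∷ flatten r ++ D ∷ []

_⧺_ : Tree → Tree → Tree
s ⧺ ε         = s
s ⧺ (l ⟨ r ⟩) = (s ⧺ l) ⟨ r ⟩

size : Tree → ℕ
size ε         = 0
size (l ⟨ r ⟩) = suc (size l + size r)

components : Tree → ℕ
components ε         = 0
components (l ⟨ r ⟩) = suc (components l)

hills : Tree → ℕ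
hills ε               = 0
hills (l ⟨ ε ⟩)       = suc (hills l)
hills (l ⟨ _ ⟨ _ ⟩ ⟩) = hills l

lastDescent : Tree → ℕ
lastDescent ε         = 0
lastDescent (l ⟨ r ⟩) = suc (lastDescent r)

-- The right spine is consumed two nodes at a time; each `wrap` is one double layer, the unit that
-- `merge` and `split` exchange for a component.
data EvenEnd : Tree → Set where
  ε    : EvenEnd ε
  wrap : ∀ q q′ {e} → EvenEnd e → EvenEnd (q ⟨ q′ ⟨ e ⟩ ⟩)

data EvenComponents : Tree → Set where
  ε    : EvenComponents ε
  _⟨_⟩ : ∀ {l e} → EvenComponents l → EvenEnd e → EvenComponents (l ⟨ e ⟩)

data 𝒜-Tree : Tree → Set where
  𝒜-tree : ∀ {l e} → EvenComponents l → ∀ q → EvenEnd e → 𝒜-Tree (l ⟨ q ⟨ e ⟩ ⟩)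

-- The bijection on trees

-- Ill-formed pairs are sent to ε.
merge : Tree → Tree → Tree
merge l         (q ⟨ q′ ⟨ e ⟩ ⟩) = merge l e ⟨ q ⟨ q′ ⟩ ⟩
merge l         (q ⟨ ε ⟩)        = ε
merge (l ⟨ e ⟩) ε                = merge l e ⟨ ε ⟩
merge ε         ε                = ε

-- The hills of `t` act as separators: the non-hills before each hill, back to the previous one,
-- become the double layers of one component on the left, and those after the last hill become the
-- layers of `e`.
split : Tree → Tree × Tree
split ε                = ε , ε
split (t ⟨ ε ⟩)        = proj₁ (split t) ⟨ proj₂ (split t) ⟩ , ε
split (t ⟨ q ⟨ q′ ⟩ ⟩) = proj₁ (split t) , q ⟨ q′ ⟨ proj₂ (split t) ⟩ ⟩

merge-split : ∀ t → merge (proj₁ (split t)) (proj₂ (split t)) ≡ t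
merge-split ε                = refl
merge-split (t ⟨ ε ⟩)        = cong _⟨ ε ⟩ (merge-split t)
merge-split (t ⟨ q ⟨ q′ ⟩ ⟩) = cong _⟨ q ⟨ q′ ⟩ ⟩ (merge-split t)

-- `EvenEnd e` avoids the clause of `merge` for ill-formed pairs, and `EvenComponents l` preserves
-- this when `e` is used up and the last component of `l` takes its place.
split-merge : ∀ {l e} → EvenComponents l → EvenEnd e → split (merge l e) ≡ (l , e)
split-merge ε         ε = refl
split-merge (l ⟨ e ⟩) ε rewrite split-merge l e = refl
split-merge l (wrap q q′ e) rewrite split-merge l e = refl

split-even : ∀ t → EvenComponents (proj₁ (split t)) × EvenEnd (proj₂ (split t))
split-even ε = ε , ε
split-even (t ⟨ ε ⟩) with l , e ← split-even t = l ⟨ e ⟩ , ε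
split-even (t ⟨ q ⟨ q′ ⟩ ⟩) with l , e ← split-even t = l , wrap q q′ e

components-split : ∀ t → components (proj₁ (split t)) ≡ hills t
components-split ε                = refl
components-split (t ⟨ ε ⟩)        = cong suc (components-split t)
components-split (t ⟨ q ⟨ q′ ⟩ ⟩) = components-split t

+-rotate : ∀ a b c → a + (b + c) ≡ (a + c) + b
+-rotate a b c = trans (cong (a +_) (+-comm b c)) (sym (+-assoc a c b))

-- Each trade preserves upsteps: a double layer and its component both have two besides those of `q`
-- and `q′`, and a hill supplies the one that encloses some eᵢ.
size-split : ∀ t → size (proj₁ (split t)) + size (proj₂ (split t)) ≡ size t
size-split ε = refl
size-split (t ⟨ ε ⟩) = cong (λ m → suc (m + 0)) (size-split t)
size-split (t ⟨ q ⟨ q′ ⟩ ⟩) = begin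
  a + suc (size q + suc (size q′ + b))   ≡⟨ +-suc a _ ⟩
  suc (a + (size q + suc (size q′ + b))) ≡⟨ cong (λ m → suc (a + m)) (+-suc (size q) _) ⟩
  suc (a + suc (size q + (size q′ + b))) ≡⟨ cong (λ m → suc (a + suc m)) (+-assoc (size q) _ b) ⟨
  suc (a + suc (size q + size q′ + b))   ≡⟨ cong suc (+-rotate a (suc (size q + size q′)) b) ⟩
  suc (a + b + suc (size q + size q′))   ≡⟨ cong (λ m → suc (m + suc (size q + size q′))) (size-split t) ⟩
  suc (size t + suc (size q + size q′))  ∎
  where
  open ≡-Reasoning
  a = size (proj₁ (split t))
  b = size (proj₂ (split t))

-- The clauses for trees outside 𝒜 are arbitrary.
encode : Tree → Tree
encode (l ⟨ q ⟨ e ⟩ ⟩) = merge l e ⟨ q ⟩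
encode _               = ε

decode : Tree → Tree
decode ε         = ε
decode (t ⟨ q ⟩) = proj₁ (split t) ⟨ q ⟨ proj₂ (split t) ⟩ ⟩

encode-decode : ∀ t → encode (decode t) ≡ t
encode-decode ε         = refl
encode-decode (t ⟨ q ⟩) = cong _⟨ q ⟩ (merge-split t)

decode-encode : ∀ {t} → 𝒜-Tree t → decode (encode t) ≡ t
decode-encode (𝒜-tree l q e) rewrite split-merge l e = refl

decode-𝒜 : ∀ t q → 𝒜-Tree (decode (t ⟨ q ⟩))
decode-𝒜 t q with l , e ← split-even t = 𝒜-tree l q e

-- The extra upstep is the one in front of e when U q D turns into U q U e D D.
size-decode : ∀ t q → size (decode (t ⟨ q ⟩)) ≡ suc (size (t ⟨ q ⟩))
size-decode t q = cong suc (begin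
  a + suc (size q + b)   ≡⟨ +-suc a _ ⟩
  suc (a + (size q + b)) ≡⟨ cong suc (+-rotate a (size q) b) ⟩
  suc (a + b + size q)   ≡⟨ cong (λ m → suc (m + size q)) (size-split t) ⟩
  suc (size t + size q)  ∎)
  where
  open ≡-Reasoning
  a = size (proj₁ (split t))
  b = size (proj₂ (split t))

components-decode : ∀ t q → components (decode (t ⟨ q ⟩)) ≡ suc (hills t)
components-decode t q = cong suc (components-split t)

-- Dyck paths as trees

flatten-++ : ∀ l r ys →
  flatten (l ⟨ r ⟩) ++ ys ≡ flatten l ++ U ∷ flatten r ++ D ∷ ys
flatten-++ l r ys = begin
  (flatten l ++ U ∷ flatten r ++ D ∷ []) ++ ys ≡⟨ ++-assoc (flatten l) _ ys ⟩
  flatten l ++ U ∷ (flatten r ++ D ∷ []) ++ ys ≡⟨ cong (λ zs → flatten l ++ U ∷ zs) (++-assoc (flatten r) _ ys) ⟩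
  flatten l ++ U ∷ flatten r ++ D ∷ ys         ∎
  where open ≡-Reasoning

flatten-⧺ : ∀ s t → flatten (s ⧺ t) ≡ flatten s ++ flatten t
flatten-⧺ s ε         = sym (++-identityʳ (flatten s))
flatten-⧺ s (l ⟨ r ⟩) = trans (cong (_++ _) (flatten-⧺ s l)) (++-assoc (flatten s) _ _)

-- A stack l₁ ∷ l₂ ∷ … with current tree t stands for the path … l₂ U l₁ U t.
-- A step D with empty stack aborts.
run : Path → List Tree → Tree → Tree
run []      _        t = t
run (U ∷ p) ls       t = run p (t ∷ ls) ε
run (D ∷ p) (l ∷ ls) t = run p ls (l ⟨ t ⟩)
run (D ∷ p) []       t = ε

parse : Path → Tree
parse p = run p [] ε

-- A balanced path restores the stack it started from. The remaining path and the stack are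
-- arbitrary so that the induction applies to both subtrees.
run-flatten : ∀ t p ls → run (flatten t ++ p) ls ε ≡ run p ls t
run-flatten ε p ls = refl
run-flatten (l ⟨ r ⟩) p ls = begin
  run (flatten (l ⟨ r ⟩) ++ p) ls ε                  ≡⟨ cong (λ xs → run xs ls ε) (flatten-++ l r p) ⟩
  run (flatten l ++ U ∷ flatten r ++ D ∷ p) ls ε     ≡⟨ run-flatten l _ ls ⟩
  run (flatten r ++ D ∷ p) (l ∷ ls) ε                ≡⟨ run-flatten r _ (l ∷ ls) ⟩
  run p ls (l ⟨ r ⟩)                                 ∎
  where open ≡-Reasoning

parse-flatten : ∀ t → parse (flatten t) ≡ t
parse-flatten t = trans (cong parse (sym (++-identityʳ (flatten t)))) (run-flatten t [] [])

flatten-injective : ∀ s t → flatten s ≡ flatten t → s ≡ t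
flatten-injective s t eq =
  trans (sym (parse-flatten s)) (trans (cong parse eq) (parse-flatten t))

-- The path already read, recovered from a state of `run`.
unwind : List Tree → Tree → Path
unwind []       t = flatten t
unwind (l ∷ ls) t = unwind ls l ++ U ∷ flatten t

unwind-⟨⟩ : ∀ ls l r → unwind ls (l ⟨ r ⟩) ≡ unwind ls l ++ U ∷ flatten r ++ D ∷ []
unwind-⟨⟩ []        l r = refl
unwind-⟨⟩ (l′ ∷ ls) l r = sym (++-assoc (unwind ls l′) _ _)

-- The starting height is a parameter so that the condition passes to the tail of a path.
NonNegativeFrom : ℤ → Path → Set
NonNegativeFrom z p = ∀ xs ys → p ≡ xs ++ ys → 0ℤ ℤ.≤ z ℤ.+ height xs

swap-rise : ∀ z s h → z ℤ.+ (rise s ℤ.+ h) ≡ (rise s ℤ.+ z) ℤ.+ h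
swap-rise z s h = trans (sym (ℤ.+-assoc z (rise s) h)) (cong (ℤ._+ h) (ℤ.+-comm z (rise s)))

NonNegativeFrom-tail : ∀ z s p → NonNegativeFrom z (s ∷ p) → NonNegativeFrom (rise s ℤ.+ z) p
NonNegativeFrom-tail z s p nn xs ys eq =
  subst (0ℤ ℤ.≤_) (swap-rise z s (height xs)) (nn (s ∷ xs) ys (cong (s ∷_) eq))

NonNegativeFrom-∷ : ∀ n s p → NonNegativeFrom (rise s ℤ.+ ℤ.+ n) p → NonNegativeFrom (ℤ.+ n) (s ∷ p)
NonNegativeFrom-∷ n s p nn [] ys eq = ℤ.+≤+ z≤n
NonNegativeFrom-∷ n s p nn (x ∷ xs) ys refl =
  subst (0ℤ ℤ.≤_) (sym (swap-rise (ℤ.+ n) x (height xs))) (nn xs ys refl)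

NonNegativeFrom-flatten : ∀ n t p → NonNegativeFrom (ℤ.+ n) p → NonNegativeFrom (ℤ.+ n) (flatten t ++ p)
NonNegativeFrom-flatten n ε         p nn = nn
NonNegativeFrom-flatten n (l ⟨ r ⟩) p nn =
  subst (NonNegativeFrom (ℤ.+ n)) (sym (flatten-++ l r p))
    (NonNegativeFrom-flatten n l _
      (NonNegativeFrom-∷ n U _
        (NonNegativeFrom-flatten (suc n) r _
          (NonNegativeFrom-∷ (suc n) D p nn))))

height-++ : ∀ xs ys → height (xs ++ ys) ≡ height xs ℤ.+ height ys
height-++ []       ys = sym (ℤ.+-identityˡ (height ys))
height-++ (x ∷ xs) ys =
  trans (cong (λ h → rise x ℤ.+ h) (height-++ xs ys)) (sym (ℤ.+-assoc (rise x) (height xs) (height ys)))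

height-flatten : ∀ t → height (flatten t) ≡ 0ℤ
height-flatten ε         = refl
height-flatten (l ⟨ r ⟩)
  rewrite height-++ (flatten l) (U ∷ flatten r ++ D ∷ [])
        | height-++ (flatten r) (D ∷ [])
        | height-flatten l | height-flatten r = refl

-- The witnesses are the final state of `run`. The stack length always equals the current height, so
-- a step D on the empty stack would go below ground.
unwind-run : ∀ p ls t → NonNegativeFrom (ℤ.+ length ls) p →
  ∃₂ λ ls′ t′ → unwind ls t ++ p ≡ unwind ls′ t′ × ℤ.+ length ls ℤ.+ height p ≡ ℤ.+ length ls′
unwind-run [] ls t nn = ls , t , ++-identityʳ _ , ℤ.+-identityʳ _
unwind-run (U ∷ p) ls t nn
  with ls′ , t′ , eq , h ← unwind-run p (t ∷ ls) ε (NonNegativeFrom-tail (ℤ.+ length ls) U p nn)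
  = ls′ , t′ , trans (sym (++-assoc (unwind ls t) _ p)) eq
  , trans (swap-rise (ℤ.+ length ls) U (height p)) h
unwind-run (D ∷ p) [] t nn with () ← nn (D ∷ []) p refl
unwind-run (D ∷ p) (l ∷ ls) t nn
  with ls′ , t′ , eq , h ← unwind-run p ls (l ⟨ t ⟩) (NonNegativeFrom-tail (ℤ.+ length (l ∷ ls)) D p nn)
  = ls′ , t′ , trans shift eq , trans (swap-rise (ℤ.+ length (l ∷ ls)) D (height p)) h
  where
  open ≡-Reasoning
  shift : unwind (l ∷ ls) t ++ D ∷ p ≡ unwind ls (l ⟨ t ⟩) ++ p
  shift = begin
    (unwind ls l ++ U ∷ flatten t) ++ D ∷ p            ≡⟨ ++-assoc (unwind ls l) _ _ ⟩
    unwind ls l ++ U ∷ flatten t ++ D ∷ p              ≡⟨ cong (λ xs → unwind ls l ++ U ∷ xs) (++-assoc (flatten t) _ p) ⟨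
    unwind ls l ++ U ∷ (flatten t ++ D ∷ []) ++ p      ≡⟨ ++-assoc (unwind ls l) _ p ⟨
    (unwind ls l ++ U ∷ flatten t ++ D ∷ []) ++ p      ≡⟨ cong (_++ p) (unwind-⟨⟩ ls l t) ⟨
    unwind ls (l ⟨ t ⟩) ++ p                           ∎

flatten-surjective : ∀ p → NonNegativeFrom 0ℤ p → height p ≡ 0ℤ → ∃ λ t → flatten t ≡ p
flatten-surjective p nn h₀ with unwind-run p [] ε nn
... | []     , t , eq , _ = t , sym eq
-- A nonempty final stack would mean a positive final height.
... | _ ∷ _  , t , eq , h
  with () ← trans (sym h) (trans (ℤ.+-identityˡ (height p)) h₀)

#-++ : ∀ s xs ys → #[ s ] (xs ++ ys) ≡ #[ s ] xs + #[ s ] ys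
#-++ s xs ys = trans (cong length (filter-++ (s ≟_) xs ys)) (length-++ (filter (s ≟_) xs))

#-flatten : ∀ s t → #[ s ] (flatten t) ≡ size t
#-flatten s ε = refl
#-flatten U (l ⟨ r ⟩)
  rewrite #-++ U (flatten l) (U ∷ flatten r ++ D ∷ []) | #-++ U (flatten r) (D ∷ [])
        | #-flatten U l | #-flatten U r | +-comm (size r) 0 = +-suc (size l) (size r)
#-flatten D (l ⟨ r ⟩)
  rewrite #-++ D (flatten l) (U ∷ flatten r ++ D ∷ []) | #-++ D (flatten r) (D ∷ [])
        | #-flatten D l | #-flatten D r | +-comm (size r) 1 = +-suc (size l) (size r)

flatten-nonNegative : ∀ t xs ys → flatten t ≡ xs ++ ys → 0ℤ ℤ.≤ height xs
flatten-nonNegative t xs ys eq =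
  subst (0ℤ ℤ.≤_) (ℤ.+-identityˡ (height xs))
    (NonNegativeFrom-flatten 0 t [] (λ { [] _ _ → ℤ.+≤+ z≤n }) xs ys (trans (++-identityʳ _) eq))

flatten-isDyck : ∀ t → IsDyck (size t) (flatten t)
flatten-isDyck t = record
  { upsteps     = #-flatten U t
  ; downsteps   = #-flatten D t
  ; endsAtZero  = height-flatten t
  ; nonNegative = flatten-nonNegative t
  }

isDyck⇒flatten : ∀ {n p} → IsDyck n p → ∃ λ t → flatten t ≡ p × size t ≡ n
isDyck⇒flatten {p = p} d
  with t , refl ← flatten-surjective p
         (λ xs ys eq → subst (0ℤ ℤ.≤_) (sym (ℤ.+-identityˡ (height xs))) (IsDyck.nonNegative d xs ys eq))
         (IsDyck.endsAtZero d)
  = t , refl , trans (sym (#-flatten U t)) (IsDyck.upsteps d)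

-- Both parts are Dyck paths, since the second starts at height 0 as well; their trees recombine to
-- `t` because `flatten` is injective.
cut-at-ground : ∀ t xs ys → flatten t ≡ xs ++ ys → height xs ≡ 0ℤ →
  ∃₂ λ s s′ → flatten s ≡ xs × flatten s′ ≡ ys × t ≡ s ⧺ s′
cut-at-ground t xs ys eq h
  with s , refl ← flatten-surjective xs
         (λ us vs e → subst (0ℤ ℤ.≤_) (sym (ℤ.+-identityˡ (height us)))
           (flatten-nonNegative t us (vs ++ ys) (trans eq (trans (cong (_++ ys) e) (++-assoc us vs ys))))) h
  with s′ , refl ← flatten-surjective ys
         (λ us vs e → subst (0ℤ ℤ.≤_) (trans (height-++ xs us) (cong (ℤ._+ height us) h))
           (flatten-nonNegative t (xs ++ us) vs (trans eq (trans (cong (xs ++_) e) (sym (++-assoc xs us vs))))))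
         (trans (sym (ℤ.+-identityˡ (height ys)))
           (trans (cong (ℤ._+ height ys) (sym h))
             (trans (sym (height-++ xs ys)) (trans (cong height (sym eq)) (height-flatten t)))))
  = s , s′ , refl , refl , flatten-injective t (s ⧺ s′) (trans eq (sym (flatten-⧺ s s′)))

-- Counting returns and early hills

-- Prepending a step to a path maps over `inits`, which is the use of `f`. Comparing the outcomes of
-- the two tests lets both filters advance together.
count-zip : ∀ {P Q : Pred (Path × Path) 0ℓ} (P? : Decidable P) (Q? : Decidable Q) (f : Path → Path) →
  (∀ xs ys → does (P? (f xs , ys)) ≡ does (Q? (xs , ys))) → ∀ xss yss →
  length (filter P? (zip (map f xss) yss)) ≡ length (filter Q? (zip xss yss))
count-zip P? Q? f eq [] yss = refl
count-zip P? Q? f eq (xs ∷ xss) [] = refl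
count-zip P? Q? f eq (xs ∷ xss) (ys ∷ yss)
  with does (P? (f xs , ys)) | does (Q? (xs , ys)) | eq xs ys
... | true  | _ | refl = cong suc (count-zip P? Q? f eq xss yss)
... | false | _ | refl = count-zip P? Q? f eq xss yss

dn udu : Path
dn  = D ∷ []
udu = U ∷ D ∷ U ∷ []

-- The pattern starts at ground level in a path whose starting point has height z.
OccursAt : Path → ℤ → Pred (Path × Path) 0ℓ
OccursAt pat z (xs , ys) = Prefix _≡_ pat ys × z ℤ.+ height xs ≡ 0ℤ

occursAt? : ∀ pat z → Decidable (OccursAt pat z)
occursAt? pat z (xs , ys) = prefix? _≟_ pat ys ×-dec (z ℤ.+ height xs ℤ.≟ 0ℤ)

occurrences : Path → ℤ → Path → ℕ
occurrences pat z p = length (filter (occursAt? pat z) (splits p))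

-- The cut before `s` is tested on its own; at all later cuts `s` is absorbed into the starting
-- height. The `if` computes away once the pattern and the height are concrete enough.
occurrences-∷ : ∀ pat z s p → occurrences pat z (s ∷ p) ≡
  (if does (occursAt? pat z ([] , s ∷ p)) then suc else id) (occurrences pat (rise s ℤ.+ z) p)
occurrences-∷ pat z s p = trans unfold (cong (if b then suc else id) step)
  where
  b = does (occursAt? pat z ([] , s ∷ p))
  shifted = length (filter (occursAt? pat z) (zip (map (s ∷_) (inits p)) (tails p)))

  unfold : occurrences pat z (s ∷ p) ≡ (if b then suc else id) shifted
  unfold with b
  ... | true  = refl
  ... | false = refl

  step : shifted ≡ occurrences pat (rise s ℤ.+ z) p
  step = count-zip (occursAt? pat z) (occursAt? pat (rise s ℤ.+ z)) (s ∷_)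
    (λ xs ys → cong (λ h → does (prefix? _≟_ pat ys) ∧ does (h ℤ.≟ 0ℤ)) (swap-rise z s (height xs)))
    (inits p) (tails p)

occurrences-∷-above : ∀ pat n s p →
  occurrences pat ℤ.+[1+ n ] (s ∷ p) ≡ occurrences pat (rise s ℤ.+ ℤ.+[1+ n ]) p
occurrences-∷-above pat n s p =
  trans (occurrences-∷ pat ℤ.+[1+ n ] s p)
    (cong (λ b → (if b then suc else id) (occurrences pat (rise s ℤ.+ ℤ.+[1+ n ]) p))
      (∧-zeroʳ (does (prefix? _≟_ pat (s ∷ p)))))

-- A Dyck path raised to positive height never touches the ground, so none of its points can count.
occurrences-above : ∀ pat n t p →
  occurrences pat ℤ.+[1+ n ] (flatten t ++ p) ≡ occurrences pat ℤ.+[1+ n ] p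
occurrences-above pat n ε p = refl
occurrences-above pat n (l ⟨ r ⟩) p = begin
  occ n (flatten (l ⟨ r ⟩) ++ p)              ≡⟨ cong (occ n) (flatten-++ l r p) ⟩
  occ n (flatten l ++ U ∷ flatten r ++ D ∷ p) ≡⟨ occurrences-above pat n l _ ⟩
  occ n (U ∷ flatten r ++ D ∷ p)              ≡⟨ occurrences-∷-above pat n U _ ⟩
  occ (suc n) (flatten r ++ D ∷ p)            ≡⟨ occurrences-above pat (suc n) r _ ⟩
  occ (suc n) (D ∷ p)                         ≡⟨ occurrences-∷-above pat (suc n) D p ⟩
  occ n p                                     ∎
  where
  open ≡-Reasoning
  occ : ℕ → Path → ℕ
  occ m = occurrences pat ℤ.+[1+ m ]

-- A return starts at height 1: lowering the path by 1 puts that point on the ground.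
returns≡occurrences : ∀ p → returns p ≡ occurrences dn -1ℤ p
returns≡occurrences p =
  subst (λ xss → length (filter returnAt? (zip xss (tails p))) ≡ occurrences dn -1ℤ p) (map-id (inits p))
    (count-zip returnAt? (occursAt? dn -1ℤ) id
      (λ xs ys → cong (λ h → does (prefix? _≟_ dn ys) ∧ does (h ℤ.≟ 0ℤ))
        (trans (height-++ xs dn) (ℤ.+-comm (height xs) -1ℤ)))
      (inits p) (tails p))

earlyHills≡occurrences : ∀ p → earlyHills p ≡ occurrences udu 0ℤ p
earlyHills≡occurrences p =
  subst (λ xss → length (filter earlyHillAt? (zip xss (tails p))) ≡ occurrences udu 0ℤ p) (map-id (inits p))
    (count-zip earlyHillAt? (occursAt? udu 0ℤ) id
      (λ xs ys → cong (λ h → does (prefix? _≟_ udu ys) ∧ does (h ℤ.≟ 0ℤ))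
        (sym (ℤ.+-identityˡ (height xs))))
      (inits p) (tails p))

-- No downstep of a Dyck path starts on its base line. This is applied to the inside of a component,
-- which lies on the ground once the path is lowered by 1.
downs-at-ground : ∀ t p →
  occurrences dn 0ℤ (flatten t ++ p) ≡ occurrences dn 0ℤ p
downs-at-ground ε p = refl
downs-at-ground (l ⟨ r ⟩) p = begin
  occ 0ℤ (flatten (l ⟨ r ⟩) ++ p)              ≡⟨ cong (occ 0ℤ) (flatten-++ l r p) ⟩
  occ 0ℤ (flatten l ++ U ∷ flatten r ++ D ∷ p) ≡⟨ downs-at-ground l _ ⟩
  occ 0ℤ (U ∷ flatten r ++ D ∷ p)              ≡⟨ occurrences-∷ dn 0ℤ U (flatten r ++ D ∷ p) ⟩
  occ 1ℤ (flatten r ++ D ∷ p)                  ≡⟨ occurrences-above dn 0 r (D ∷ p) ⟩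
  occ 1ℤ (D ∷ p)                               ≡⟨ occurrences-∷ dn 1ℤ D p ⟩
  occ 0ℤ p                                     ∎
  where
  open ≡-Reasoning
  occ = occurrences dn

returns-flatten-++ : ∀ t p →
  occurrences dn -1ℤ (flatten t ++ p) ≡ components t + occurrences dn -1ℤ p
returns-flatten-++ ε p = refl
returns-flatten-++ (l ⟨ r ⟩) p = begin
  occ -1ℤ (flatten (l ⟨ r ⟩) ++ p)                   ≡⟨ cong (occ -1ℤ) (flatten-++ l r p) ⟩
  occ -1ℤ (flatten l ++ U ∷ flatten r ++ D ∷ p)      ≡⟨ returns-flatten-++ l _ ⟩
  components l + occ -1ℤ (U ∷ flatten r ++ D ∷ p)    ≡⟨ cong (components l +_) (occurrences-∷ dn -1ℤ U (flatten r ++ D ∷ p)) ⟩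
  components l + occ 0ℤ (flatten r ++ D ∷ p)         ≡⟨ cong (components l +_) (downs-at-ground r _) ⟩
  components l + occ 0ℤ (D ∷ p)                      ≡⟨ cong (components l +_) (occurrences-∷ dn 0ℤ D p) ⟩
  components l + suc (occ -1ℤ p)                     ≡⟨ +-suc (components l) _ ⟩
  suc (components l + occ -1ℤ p)                     ∎
  where
  open ≡-Reasoning
  occ = occurrences dn

returns-flatten : ∀ t → returns (flatten t) ≡ components t
returns-flatten t = begin
  returns (flatten t)                   ≡⟨ returns≡occurrences (flatten t) ⟩
  occurrences dn -1ℤ (flatten t)        ≡⟨ cong (occurrences dn -1ℤ) (++-identityʳ (flatten t)) ⟨
  occurrences dn -1ℤ (flatten t ++ [])  ≡⟨ returns-flatten-++ t [] ⟩
  components t + 0                      ≡⟨ +-comm (components t) 0 ⟩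
  components t                          ∎
  where open ≡-Reasoning

flatten-head : ∀ l r → ∃ λ p → flatten (l ⟨ r ⟩) ≡ U ∷ p
flatten-head ε         r  = _ , refl
flatten-head (l ⟨ r ⟩) r′ with p , eq ← flatten-head l r = _ , cong (_++ _) eq

udu-hill : ∀ p → occurrences udu 0ℤ (U ∷ D ∷ U ∷ p) ≡ suc (occurrences udu 0ℤ (U ∷ p))
udu-hill p = trans (occurrences-∷ udu 0ℤ U (D ∷ U ∷ p)) (cong suc (occurrences-∷ udu 1ℤ D (U ∷ p)))

-- A nonempty Dyck path begins with U, so the component opens with UU and the pattern fails there;
-- the rest of it stays above ground until its closing D.
udu-no-hill : ∀ l r p → occurrences udu 0ℤ (U ∷ flatten (l ⟨ r ⟩) ++ D ∷ p) ≡ occurrences udu 0ℤ p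
udu-no-hill l r p = begin
  occ 0ℤ (U ∷ flatten (l ⟨ r ⟩) ++ D ∷ p)  ≡⟨ first-step ⟩
  occ 1ℤ (flatten (l ⟨ r ⟩) ++ D ∷ p)      ≡⟨ occurrences-above udu 0 (l ⟨ r ⟩) (D ∷ p) ⟩
  occ 1ℤ (D ∷ p)                           ≡⟨ occurrences-∷ udu 1ℤ D p ⟩
  occ 0ℤ p                                 ∎
  where
  open ≡-Reasoning
  occ = occurrences udu
  first-step : occ 0ℤ (U ∷ flatten (l ⟨ r ⟩) ++ D ∷ p) ≡ occ 1ℤ (flatten (l ⟨ r ⟩) ++ D ∷ p)
  first-step with xs , eq ← flatten-head l r rewrite eq =
    occurrences-∷ udu 0ℤ U (U ∷ xs ++ D ∷ p)

-- The U that follows makes every hill of `t` early, including a hill in last position.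
hills-flatten-++ : ∀ t p →
  occurrences udu 0ℤ (flatten t ++ U ∷ p) ≡ hills t + occurrences udu 0ℤ (U ∷ p)
hills-flatten-++ ε p = refl
hills-flatten-++ (l ⟨ ε ⟩) p = begin
  occ (flatten (l ⟨ ε ⟩) ++ U ∷ p)        ≡⟨ cong occ (flatten-++ l ε (U ∷ p)) ⟩
  occ (flatten l ++ U ∷ D ∷ U ∷ p)        ≡⟨ hills-flatten-++ l (D ∷ U ∷ p) ⟩
  hills l + occ (U ∷ D ∷ U ∷ p)           ≡⟨ cong (hills l +_) (udu-hill p) ⟩
  hills l + suc (occ (U ∷ p))             ≡⟨ +-suc (hills l) _ ⟩
  suc (hills l + occ (U ∷ p))             ∎
  where
  open ≡-Reasoning
  occ = occurrences udu 0ℤ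
hills-flatten-++ (l ⟨ q ⟨ r ⟩ ⟩) p = begin
  occ (flatten (l ⟨ q ⟨ r ⟩ ⟩) ++ U ∷ p)                ≡⟨ cong occ (flatten-++ l (q ⟨ r ⟩) (U ∷ p)) ⟩
  occ (flatten l ++ U ∷ flatten (q ⟨ r ⟩) ++ D ∷ U ∷ p) ≡⟨ hills-flatten-++ l (flatten (q ⟨ r ⟩) ++ D ∷ U ∷ p) ⟩
  hills l + occ (U ∷ flatten (q ⟨ r ⟩) ++ D ∷ U ∷ p)    ≡⟨ cong (hills l +_) (udu-no-hill q r (U ∷ p)) ⟩
  hills l + occ (U ∷ p)                                 ∎
  where
  open ≡-Reasoning
  occ = occurrences udu 0ℤ

-- The last component makes all hills of `t` early, but no U follows it, so it is never an early
-- hill itself.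
earlyHills-flatten : ∀ t r → earlyHills (flatten (t ⟨ r ⟩)) ≡ hills t
earlyHills-flatten t r = begin
  earlyHills (flatten (t ⟨ r ⟩))                                ≡⟨ earlyHills≡occurrences (flatten (t ⟨ r ⟩)) ⟩
  occurrences udu 0ℤ (flatten t ++ U ∷ flatten r ++ D ∷ [])     ≡⟨ hills-flatten-++ t (flatten r ++ D ∷ []) ⟩
  hills t + occurrences udu 0ℤ (U ∷ flatten r ++ D ∷ [])        ≡⟨ cong (hills t +_) (last-component r) ⟩
  hills t + 0                                                   ≡⟨ +-comm (hills t) 0 ⟩
  hills t                                                       ∎
  where
  open ≡-Reasoning
  last-component : ∀ r → occurrences udu 0ℤ (U ∷ flatten r ++ D ∷ []) ≡ 0
  last-component ε         = refl
  last-component (q ⟨ r ⟩) = udu-no-hill q r []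

-- Descents to ground level

last-∷ʳ : ∀ (xs : Path) x → last (xs ∷ʳ x) ≡ just x
last-∷ʳ []           x = refl
last-∷ʳ (_ ∷ [])     x = refl
last-∷ʳ (_ ∷ y ∷ xs) x = last-∷ʳ (y ∷ xs) x

last-++-U∷ : ∀ xs {ys} → last ys ≢ just D → last (xs ++ U ∷ ys) ≢ just D
last-++-U∷ []           {[]}    _  ()
last-++-U∷ []           {_ ∷ _} y  = y
last-++-U∷ (_ ∷ [])     {ys}    y  = last-++-U∷ [] {ys} y
last-++-U∷ (_ ∷ x ∷ xs) {ys}    y  = last-++-U∷ (x ∷ xs) {ys} y

++-replicate-suc : ∀ (xs : Path) n → xs ++ replicate (suc n) D ≡ (xs ++ replicate n D) ∷ʳ D
++-replicate-suc []       zero    = refl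
++-replicate-suc []       (suc n) = cong (D ∷_) (++-replicate-suc [] n)
++-replicate-suc (x ∷ xs) n       = cong (x ∷_) (++-replicate-suc xs n)

-- Final steps D are removed from both sides together; if one run ended first, the part before it
-- would end in D.
last-descent-unique : ∀ {xs ys} m n → last xs ≢ just D → last ys ≢ just D →
  xs ++ replicate m D ≡ ys ++ replicate n D → m ≡ n
last-descent-unique zero zero _ _ _ = refl
last-descent-unique {xs} {ys} zero (suc n) x _ eq = ⊥-elim (x
  (trans (cong last (trans (sym (++-identityʳ xs)) (trans eq (++-replicate-suc ys n)))) (last-∷ʳ (ys ++ replicate n D) D)))
last-descent-unique {xs} {ys} (suc m) zero _ y eq = ⊥-elim (y
  (trans (cong last (trans (sym (++-identityʳ ys)) (trans (sym eq) (++-replicate-suc xs m)))) (last-∷ʳ (xs ++ replicate m D) D)))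
last-descent-unique {xs} {ys} (suc m) (suc n) x y eq = cong suc (last-descent-unique m n x y
  (∷ʳ-injectiveˡ (xs ++ replicate m D) (ys ++ replicate n D)
    (trans (sym (++-replicate-suc xs m)) (trans eq (++-replicate-suc ys n)))))

flatten-lastDescent : ∀ t → ∃ λ xs → flatten t ≡ xs ++ replicate (lastDescent t) D × last xs ≢ just D
flatten-lastDescent ε = [] , refl , λ ()
flatten-lastDescent (l ⟨ r ⟩) with xs , eq , x ← flatten-lastDescent r =
  flatten l ++ U ∷ xs , shift , last-++-U∷ (flatten l) {xs} x
  where
  open ≡-Reasoning
  n = lastDescent r
  shift : flatten (l ⟨ r ⟩) ≡ (flatten l ++ U ∷ xs) ++ replicate (suc n) D
  shift = begin
    flatten l ++ U ∷ (flatten r ∷ʳ D)                 ≡⟨ cong (λ p → flatten l ++ U ∷ (p ∷ʳ D)) eq ⟩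
    flatten l ++ U ∷ ((xs ++ replicate n D) ∷ʳ D)     ≡⟨ cong (λ p → flatten l ++ U ∷ p) (++-replicate-suc xs n) ⟨
    flatten l ++ U ∷ xs ++ replicate (suc n) D        ≡⟨ ++-assoc (flatten l) _ _ ⟨
    (flatten l ++ U ∷ xs) ++ replicate (suc n) D      ∎

lastDescent-unique : ∀ t {xs} n → last xs ≢ just D → flatten t ≡ xs ++ replicate n D → n ≡ lastDescent t
lastDescent-unique t n x eq with ys , eq′ , y ← flatten-lastDescent t =
  last-descent-unique n (lastDescent t) x y (trans (sym eq) eq′)

-- Supplies the descents to which the conditions of `𝒜` are applied. The equation with `p` allows
-- one fixed path to be cut after any of its components.
component-descent : ∀ {p} l r ys → flatten (l ⟨ r ⟩) ++ ys ≡ p → head ys ≢ just D →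
  ∃ λ (d : Descent p) → len d ≡ suc (lastDescent r) × Descent.after d ≡ ys × ToGround d
component-descent l r ys p≡ y with xs , eq , x ← flatten-lastDescent (l ⟨ r ⟩) =
  record
    { before    = xs
    ; after     = ys
    ; len       = suc (lastDescent r)
    ; nonEmpty  = s≤s z≤n
    ; splitting = trans (sym p≡) (trans (cong (_++ ys) eq) (++-assoc xs _ ys))
    ; maximalˡ  = x
    ; maximalʳ  = y
    }
  , refl , refl , trans (cong height (sym eq)) (height-flatten (l ⟨ r ⟩))

even-+2 : ∀ {n} → Even n → Even (2 + n)
even-+2 = ∣m∣n⇒∣m+n ∣-refl

even-∸2 : ∀ {n} → Even (2 + n) → Even n
even-∸2 e = ∣m+n∣m⇒∣n e ∣-refl

¬even-1 : ¬ Even 1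
¬even-1 e with () ← ∣1⇒≡1 e

EvenEnd⇒even : ∀ {t} → EvenEnd t → Even (lastDescent t)
EvenEnd⇒even ε            = 2 ∣0
EvenEnd⇒even (wrap _ _ e) = even-+2 (EvenEnd⇒even e)

EvenEnd⇒odd-suc : ∀ {t} → EvenEnd t → Odd (suc (lastDescent t))
EvenEnd⇒odd-suc ε            = ¬even-1
EvenEnd⇒odd-suc (wrap _ _ e) = EvenEnd⇒odd-suc e ∘ even-∸2

even⇒EvenEnd : ∀ t → Even (lastDescent t) → EvenEnd t
even⇒EvenEnd ε                _ = ε
even⇒EvenEnd (q ⟨ ε ⟩)        e = ⊥-elim (¬even-1 e)
even⇒EvenEnd (q ⟨ q′ ⟨ t ⟩ ⟩) e = wrap q q′ (even⇒EvenEnd t (even-∸2 e))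

odd-suc⇒EvenEnd : ∀ t → Odd (suc (lastDescent t)) → EvenEnd t
odd-suc⇒EvenEnd ε                _ = ε
odd-suc⇒EvenEnd (q ⟨ ε ⟩)        o = ⊥-elim (o ∣-refl)
odd-suc⇒EvenEnd (q ⟨ q′ ⟨ t ⟩ ⟩) o = wrap q q′ (odd-suc⇒EvenEnd t (o ∘ even-+2))

EvenComponents-⧺ˡ : ∀ s t → EvenComponents (s ⧺ t) → EvenComponents s
EvenComponents-⧺ˡ s ε         es        = es
EvenComponents-⧺ˡ s (l ⟨ r ⟩) (es ⟨ _ ⟩) = EvenComponents-⧺ˡ s l es

-- The nonempty tree on the right ensures that `l ⟨ r ⟩` does not end in the last component, so it
-- is an initial part of the components known to be even.
inner-component-even : ∀ l r s q → 𝒜-Tree (l ⟨ r ⟩ ⧺ (s ⟨ q ⟩)) → EvenEnd r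
inner-component-even l r s q a = go a refl
  where
  go : ∀ {t} → 𝒜-Tree t → t ≡ l ⟨ r ⟩ ⧺ (s ⟨ q ⟩) → EvenEnd r
  go (𝒜-tree es _ _) refl with _ ⟨ e ⟩ ← EvenComponents-⧺ˡ (l ⟨ r ⟩) s es = e

𝒜-Tree⇒𝒜 : ∀ {t} → 𝒜-Tree t → 𝒜 (size t) (flatten t)
𝒜-Tree⇒𝒜 {t} a@(𝒜-tree {e = e} _ q ev) = record
  { isDyck       = flatten-isDyck t
  ; terminalEven = terminal
  ; othersOdd    = others
  }
  where
  terminal : (d : Descent (flatten t)) → IsTerminal d → Even (len d)
  terminal record { before = xs ; splitting = eq ; len = n ; maximalˡ = x } refl =
    subst Even (sym (lastDescent-unique t n x (trans eq (cong (xs ++_) (++-identityʳ (replicate n D)))))) (even-+2 (EvenEnd⇒even ev))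

  others : (d : Descent (flatten t)) → ToGround d → ¬ IsTerminal d → Odd (len d)
  others record { before = xs ; after = ys ; len = n@(suc _) ; splitting = eq ; maximalˡ = x } ground inner
    with cut-at-ground t (xs ++ replicate n D) ys (trans eq (sym (++-assoc xs _ ys))) ground
  -- The path is cut at the end of the descent. An empty right part would make the descent terminal,
  -- and an empty left part leaves no room for it; otherwise it closes an inner component.
  ... | s       , ε         , _  , s′≡ , _  = λ _ → inner (sym s′≡)
  ... | ε       , _ ⟨ _ ⟩   , s≡ , _   , _  = λ _ → 1+n≢0 (lastDescent-unique ε n x s≡)
  ... | l ⟨ r ⟩ , l′ ⟨ r′ ⟩ , s≡ , _   , t≡ =
    subst Odd (sym (lastDescent-unique (l ⟨ r ⟩) n x s≡))
      (EvenEnd⇒odd-suc (inner-component-even l r l′ r′ (subst 𝒜-Tree t≡ a)))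

-- The empty path has no descents and meets the parity conditions vacuously, hence the exclusion of
-- `ε`.
𝒜⇒𝒜-Tree : ∀ {n} t → 𝒜 n (flatten t) → t ≢ ε → 𝒜-Tree t
𝒜⇒𝒜-Tree ε         a t≢ε = ⊥-elim (t≢ε refl)
𝒜⇒𝒜-Tree (l ⟨ r ⟩) a t≢ε = last-component r terminal (inner l _ refl)
  where
  terminal : Even (suc (lastDescent r))
  terminal with d , n≡ , after≡ , _ ← component-descent l r [] (++-identityʳ _) (λ ()) =
    subst Even n≡ (𝒜.terminalEven a d after≡)

  inner-odd : ∀ s r′ ys → flatten (s ⟨ r′ ⟩) ++ U ∷ ys ≡ flatten (l ⟨ r ⟩) → Odd (suc (lastDescent r′))
  inner-odd s r′ ys eq with d , n≡ , after≡ , ground ← component-descent s r′ (U ∷ ys) eq (λ ()) =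
    subst Odd n≡ (𝒜.othersOdd a d ground (λ ends → ∷≢[] (trans (sym after≡) ends)))
    where
    ∷≢[] : U ∷ ys ≢ []
    ∷≢[] ()

  -- The U after `s` makes the descent that ends there maximal and not terminal; the induction
  -- removes the components of `s` from the right.
  inner : ∀ s ys → flatten s ++ U ∷ ys ≡ flatten (l ⟨ r ⟩) → EvenComponents s
  inner ε           ys eq = ε
  inner (s ⟨ r′ ⟩)  ys eq =
    inner s (flatten r′ ++ D ∷ U ∷ ys) (trans (sym (flatten-++ s r′ (U ∷ ys))) eq)
      ⟨ odd-suc⇒EvenEnd r′ (inner-odd s r′ ys eq) ⟩

  last-component : ∀ r → Even (suc (lastDescent r)) → EvenComponents l → 𝒜-Tree (l ⟨ r ⟩)
  last-component ε         e es = ⊥-elim (¬even-1 e)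
  last-component (q ⟨ e ⟩) ev es = 𝒜-tree es q (even⇒EvenEnd e (even-∸2 ev))

𝒜⇒flatten : ∀ {n p} → 𝒜 (suc n) p → ∃ λ t → flatten t ≡ p × 𝒜-Tree t × size t ≡ suc n
𝒜⇒flatten a with isDyck⇒flatten (𝒜.isDyck a)
... | l ⟨ r ⟩ , refl , size≡ = l ⟨ r ⟩ , refl , 𝒜⇒𝒜-Tree (l ⟨ r ⟩) a (λ ()) , size≡

-- The bijection on paths

encodePath decodePath : Path → Path
encodePath p = flatten (encode (parse p))
decodePath p = flatten (decode (parse p))

encodePath-flatten : ∀ t → encodePath (flatten t) ≡ flatten (encode t)
encodePath-flatten t = cong (flatten ∘ encode) (parse-flatten t)

decodePath-flatten : ∀ t → decodePath (flatten t) ≡ flatten (decode t)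
decodePath-flatten t = cong (flatten ∘ decode) (parse-flatten t)

decodePath-encodePath : ∀ {n p} → 𝒜 (suc n) p → decodePath (encodePath p) ≡ p
decodePath-encodePath a with t , refl , t∈𝒜 , _ ← 𝒜⇒flatten a = begin
  decodePath (encodePath (flatten t)) ≡⟨ cong decodePath (encodePath-flatten t) ⟩
  decodePath (flatten (encode t))     ≡⟨ decodePath-flatten (encode t) ⟩
  flatten (decode (encode t))         ≡⟨ cong flatten (decode-encode t∈𝒜) ⟩
  flatten t                           ∎
  where open ≡-Reasoning

encodePath-decodePath : ∀ {n p} → IsDyck n p → encodePath (decodePath p) ≡ p
encodePath-decodePath d with t , refl , _ ← isDyck⇒flatten d = begin
  encodePath (decodePath (flatten t)) ≡⟨ cong encodePath (decodePath-flatten t) ⟩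
  encodePath (flatten (decode t))     ≡⟨ encodePath-flatten (decode t) ⟩
  flatten (encode (decode t))         ≡⟨ cong flatten (encode-decode t) ⟩
  flatten t                           ∎
  where open ≡-Reasoning

HasReturns HasEarlyHills : ℕ → ℕ → Pred Path 0ℓ
HasReturns    n k p = 𝒜 n p × returns p ≡ k
HasEarlyHills n k p = IsDyck n p × earlyHills p ≡ k

encodePath-image : ∀ {n k p} → HasReturns (suc n) (suc k) p → HasEarlyHills n k (encodePath p)
encodePath-image {n} {k} (a , returns≡)
  with t , refl , t∈𝒜 , size≡ ← 𝒜⇒flatten a
  = subst (HasEarlyHills n k) (sym (encodePath-flatten t))
      (image (encode t) (decode-encode t∈𝒜) t∈𝒜)
  where
  open ≡-Reasoning
  -- Size and components are known for `decode`, so `t` is replaced by `decode u`; the case `ε`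
  -- would give the empty tree, which is no `𝒜-Tree`.
  image : ∀ u → decode u ≡ t → 𝒜-Tree t → HasEarlyHills n k (flatten u)
  image ε         refl ()
  image (u ⟨ q ⟩) refl _  =
      subst (λ m → IsDyck m (flatten (u ⟨ q ⟩)))
        (suc-injective (trans (sym (size-decode u q)) size≡)) (flatten-isDyck (u ⟨ q ⟩))
    , suc-injective (begin
        suc (earlyHills (flatten (u ⟨ q ⟩))) ≡⟨ cong suc (earlyHills-flatten u q) ⟩
        suc (hills u)                        ≡⟨ components-decode u q ⟨
        components (decode (u ⟨ q ⟩))        ≡⟨ returns-flatten (decode (u ⟨ q ⟩)) ⟨
        returns (flatten (decode (u ⟨ q ⟩))) ≡⟨ returns≡ ⟩
        suc k                                ∎)

decodePath-image : ∀ {n k p} → HasEarlyHills (suc n) k p → HasReturns (2 + n) (suc k) (decodePath p)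
decodePath-image {n} {k} (d , hills≡) with isDyck⇒flatten d
-- The size is positive, so there is a last component to receive e.
... | t ⟨ q ⟩ , refl , size≡ =
  subst (HasReturns (2 + n) (suc k)) (sym (decodePath-flatten (t ⟨ q ⟩)))
    ( subst (λ m → 𝒜 m (flatten (decode (t ⟨ q ⟩)))) (trans (size-decode t q) (cong suc size≡))
        (𝒜-Tree⇒𝒜 (decode-𝒜 t q))
    , (begin
        returns (flatten (decode (t ⟨ q ⟩))) ≡⟨ returns-flatten (decode (t ⟨ q ⟩)) ⟩
        components (decode (t ⟨ q ⟩))        ≡⟨ components-decode t q ⟩
        suc (hills t)                        ≡⟨ cong suc (earlyHills-flatten t q) ⟨
        suc (earlyHills (flatten (t ⟨ q ⟩))) ≡⟨ cong suc hills≡ ⟩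
        suc k                                ∎))
  where open ≡-Reasoning

theorem2 : (n k : ℕ) → 2 ≤ n → 1 ≤ k →
    Bijection (PathsWith (λ p → 𝒜 n p × returns p ≡ k))
    (PathsWith (λ p → IsDyck (n ∸ 1) p × earlyHills p ≡ k ∸ 1))
-- Matching on the bounds lets `n ∸ 1` and `k ∸ 1` compute, and leaves Dyck paths of positive size
-- on the right.
theorem2 (suc (suc n)) (suc k) (s≤s (s≤s _)) (s≤s _) = Inverse⇒Bijection (record
  { to        = λ (p , h) → encodePath p , encodePath-image h
  ; from      = λ (p , h) → decodePath p , decodePath-image h
  ; to-cong   = cong encodePath
  ; from-cong = cong decodePath
  ; inverse   = (λ {(p , d , _)} eq → trans (cong encodePath eq) (encodePath-decodePath d))
              , (λ {(p , a , _)} eq → trans (cong decodePath eq) (decodePath-encodePath a))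
  })
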